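{- Let $\Sigma$ be an alphabet and let $L \subseteq \Sigma^*$ be a finite language over $\Sigma$ (that is, $L$ is a finite set of words). Then there exists a Turing machine $M$ with input alphabet $\Sigma$ such that $M$ accepts the language $L$ and, in addition, for every natural number $k$ and every word $w \in \Sigma^*$ of length $k$, the machine $M$ started on input $w$ stops in at most $k+1$ steps.
   Context: An alphabet is a finite set of symbols, and $\Sigma^*$ denotes the set of all finite words over $\Sigma$, including the empty word. The length of a word is its number of letters. Turing machines are deterministic and single-tape. A Turing machine is a tuple $M = (\Sigma, \Gamma, Q, \delta)$, where $\Sigma$ is the finite input alphabet; $\Gamma$ is the finite tape alphabet, with $\Sigma \subseteq \Gamma$ and a blank symbol $b \in \Gamma \setminus \Sigma$; $Q$ is a finite set of states containing three distinguished, pairwise distinct states $q_{start}, q_{accept}, q_{reject}$; and the transition function is $\delta : (Q \setminus \{q_{accept}, q_{reject}\}) \times \Gamma \to Q \times \Gamma \times \{ -1, 1\}$. Here $\delta(q,s) = (q', s', d)$ means that in state $q$, reading symbol $s$, the machine writes $s'$ in the scanned cell, moves the head by one cell (right if $d = 1$, left if $d = -1$) and enters state $q'$. One application of $\delta$ is one step. The tape is a two-way infinite sequence of cells. On input $w \in \Sigma^*$, the machine starts in state $q_{start}$, with $w$ written on consecutive cells, all other cells containing $b$, and the head on the first symbol of $w$ (on a blank cell if $w$ is empty). The machine stops when it enters $q_{accept}$ or $q_{reject}$. It accepts $w$ if it stops in state $q_{accept}$. The machine $M$ accepts the language $L$ if $L$ is exactly the set of words $w \in \Sigma^*$ that $M$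 accepts. -}

module Defs where

open import Data.Bool.Base using (if_then_else_)
open import Data.Fin.Base using (Fin)
open import Data.Integer.Base as ℤ using (ℤ; +_; -[1+_]; 0ℤ; 1ℤ; -1ℤ)
import Data.Integer.Properties as ℤ
open import Data.Irrelevant using ([_])
open import Data.List.Base using (List; []; _∷_)
open import Data.List.Membership.Propositional using (_∈_)
open import Data.Nat.Base using (ℕ; zero; suc; _≤_)
open import Data.Product.Base using (_×_; _,_; ∃; ∃-syntax)
open import Data.Refinement.Base using (Refinement-syntax; _,_)
open import Data.Sum.Base using (_⊎_)
open import Function.Bundles using (_↔_; _↣_; _⇔_; Injection)
open import Level using (0ℓ)
open import Relation.Binary.PropositionalEquality.Core using (_≡_; _≢_)
open import Relation.Nullary.Decidable.Core using (does)
open import Relation.Unary using (Pred)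

Finite : Set → Set
Finite A = ∃[ n ] (A ↔ Fin n)

Language : Set → Set₁
Language A = Pred (List A) 0ℓ

FiniteLanguage : {A : Set} → Language A → Set
FiniteLanguage L = ∃[ ws ] (∀ w → L w ⇔ w ∈ ws)

data Direction : Set where
  left right : Direction

move : Direction → ℤ → ℤ
move left  i = i ℤ.+ -1ℤ
move right i = i ℤ.+ 1ℤ

record TuringMachine (A : Set) : Set₁ where
  field
    Γ           : Set
    Γ-finite    : Finite Γ
    -- The inclusion of the input alphabet in the tape alphabet.
    inclusion   : A ↣ Γ
    blank       : Γ
    blank-fresh : ∀ a → Injection.to inclusion a ≢ blank

    Q             : Set
    Q-finite      : Finite Q
    start         : Q
    accept        : Q
    reject        : Q
    start≢accept  : start ≢ accept
    start≢reject  : start ≢ reject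
    accept≢reject : accept ≢ reject

  Working : Set
  Working = [ q ∈ Q ∣ q ≢ accept × q ≢ reject ]

  field
    δ : Working × Γ → Q × Γ × Direction

  Tape : Set
  Tape = ℤ → Γ

  write : Tape → ℤ → Γ → Tape
  write t i s j = if does (j ℤ.≟ i) then s else t j

  record Config : Set where
    constructor ⟨_,_,_⟩
    field
      state : Q
      tape  : Tape
      head  : ℤ

  open Config public

  data _⟶_ : Config → Config → Set where
    step : ∀ {q t h q′ s′ d} .(q-working : q ≢ accept × q ≢ reject) →
           δ ((q , [ q-working ]) , t h) ≡ (q′ , s′ , d) →
           ⟨ q , t , h ⟩ ⟶ ⟨ q′ , write t h s′ , move d h ⟩

  data _⟶[_]_ : Config → ℕ → Config → Set where
    done : ∀ {c} → c ⟶[ zero ] c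
    _◅_  : ∀ {c c′ c″ n} → c ⟶ c′ → c′ ⟶[ n ] c″ → c ⟶[ suc n ] c″

  infixr 5 _◅_

  cells : List A → ℕ → Γ
  cells []      _       = blank
  cells (a ∷ w) zero    = Injection.to inclusion a
  cells (a ∷ w) (suc n) = cells w n

  inputTape : List A → Tape
  inputTape w (+ n)    = cells w n
  inputTape w -[1+ n ] = blank

  initial : List A → Config
  initial w = ⟨ start , inputTape w , 0ℤ ⟩

  Halted : Config → Set
  Halted c = state c ≡ accept ⊎ state c ≡ reject

  Accepts : List A → Set
  Accepts w = ∃[ n ] ∃[ c ] (initial w ⟶[ n ] c × state c ≡ accept)

  StopsWithin : ℕ → List A → Set
  StopsWithin m w = ∃[ n ] ∃[ c ] (n ≤ m × initial w ⟶[ n ] c × Halted c)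

  AcceptsLanguage : Language A → Set
  AcceptsLanguage L = ∀ w → L w ⇔ Accepts w

{-# OPTIONS --safe #-}
module Submission where

open import Data.Empty using (⊥-elim; ⊥-elim-irr)
open import Data.Fin.Base using (Fin; zero; suc)
open import Data.Fin.Patterns using (0F; 1F)
import Data.Fin.Properties as Fin
open import Data.Integer.Base as ℤ using (ℤ; +_; 0ℤ; 1ℤ)
import Data.Integer.Properties as ℤ
open import Data.List.Base using (List; []; _∷_; _++_; _∷ʳ_; length; lookup; inits; concatMap)
import Data.List.Properties as List
open import Data.List.Membership.Propositional using (_∈_; _∉_; lose)
open import Data.List.Membership.Propositional.Properties using (∈-map⁺)
import Data.List.Membership.DecPropositional as DecMembership
open import Data.List.Relation.Unary.Any using (here; there; index)
open import Data.List.Relation.Unary.Any.Properties using (concatMap⁺; lookup-index)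
open import Data.Maybe.Base using (Maybe; just; nothing; maybe)
open import Data.Maybe.Properties using (just-injective)
open import Data.Nat.Base using (ℕ; zero; suc; _+_; _≤_; z≤n; s≤s)
import Data.Nat.Properties as ℕ
open import Data.Product.Base using (_×_; _,_; proj₁; proj₂; ∃-syntax)
open import Data.Refinement.Base using (value)
open import Data.Sum.Base using (inj₁; inj₂)
open import Function.Base using (_∘_)
open import Function.Bundles using (_⇔_; Inverse; mk⇔; mk↔ₛ′; mk↣)
open import Function.Construct.Composition using (_⇔-∘_)
open import Function.Properties.Inverse using (↔-refl; ↔⇒↣)
open import Relation.Binary.Definitions using (DecidableEquality)
open import Relation.Binary.PropositionalEquality
  using (_≡_; refl; sym; trans; cong; subst)
open import Relation.Nullary.Decidable using (Dec; yes; no; via-injection)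
open import Relation.Nullary.Negation using (¬_)
open import Defs

-- The machine moves right only and remembers the word read so far, as a position in a list of
-- all prefixes of words of L. A letter that leads out of that list rules out membership in L, so
-- the machine rejects at once; on the first blank the whole input has been read, and the machine
-- decides by looking it up.

Finite-≟ : {A : Set} → Finite A → DecidableEquality A
Finite-≟ (_ , A↔Fin) = via-injection (↔⇒↣ A↔Fin) Fin._≟_

Maybe-finite : {A : Set} → Finite A → Finite (Maybe A)
Maybe-finite {A} (n , A↔Fin) = suc n , mk↔ₛ′ to from to∘from from∘to
  where
  module I = Inverse A↔Fin

  to : Maybe A → Fin (suc n)
  to = maybe (suc ∘ I.to) zero

  from : Fin (suc n) → Maybe A
  from zero    = nothing
  from (suc i) = just (I.from i)

  to∘from : ∀ i → to (from i) ≡ i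
  to∘from zero    = refl
  to∘from (suc i) = cong suc (I.strictlyInverseˡ i)

  from∘to : ∀ x → from (to x) ≡ x
  from∘to nothing  = refl
  from∘to (just a) = cong just (I.strictlyInverseʳ a)

++∈inits : {A : Set} (u v : List A) → u ∈ inits (u ++ v)
++∈inits []      v = here refl
++∈inits (a ∷ u) v = there (∈-map⁺ (a ∷_) (++∈inits u v))

module Determinism {A : Set} (M : TuringMachine A) where
  open TuringMachine M

  halted-stuck : ∀ {c c′} → Halted c → ¬ (c ⟶ c′)
  halted-stuck (inj₁ refl) (step q-working _) = ⊥-elim-irr (proj₁ q-working refl)
  halted-stuck (inj₂ refl) (step q-working _) = ⊥-elim-irr (proj₂ q-working refl)

  ⟶-deterministic : ∀ {c c₁ c₂} → c ⟶ c₁ → c ⟶ c₂ → c₁ ≡ c₂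
  ⟶-deterministic (step _ e₁) (step _ e₂) with refl ← trans (sym e₁) e₂ = refl

  -- `Accepts` only asks for some accepting run; to conclude anything from it, that run must be
  -- compared with the one constructed below. Determinism keeps the two in lockstep, and neither can
  -- continue where the other has halted.
  halting-unique : ∀ {c c₁ c₂ m n} → c ⟶[ m ] c₁ → Halted c₁ →
                   c ⟶[ n ] c₂ → Halted c₂ → c₁ ≡ c₂
  halting-unique done     _  done     _  = refl
  halting-unique done     h₁ (s ◅ _)  _  = ⊥-elim (halted-stuck h₁ s)
  halting-unique (s ◅ _)  _  done     h₂ = ⊥-elim (halted-stuck h₂ s)
  halting-unique (s ◅ r₁) h₁ (s′ ◅ r₂) h₂
    with refl ← ⟶-deterministic s s′ = halting-unique r₁ h₁ r₂ h₂

module PrefixMachine {A : Set} (A-finite : Finite A) (ws : List (List A)) where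

  open DecMembership (List.≡-dec (Finite-≟ A-finite)) using (_∈?_)

  -- The leading `[]` is there even if `ws` is empty, so position `0F` always denotes the empty word
  -- and can serve as the start state. Repetitions are harmless.
  prefixes : List (List A)
  prefixes = [] ∷ concatMap inits ws

  ++∈⇒∈prefixes : ∀ u v → u ++ v ∈ ws → u ∈ prefixes
  ++∈⇒∈prefixes u v uv∈ws = there (concatMap⁺ inits (lose uv∈ws (++∈inits u v)))

  State : Set
  State = Fin (2 + length prefixes)

  pattern accepting = 0F
  pattern rejecting = 1F
  pattern reading i = suc (suc i)

  afterBlank : {u : List A} → Dec (u ∈ ws) → State
  afterBlank (yes _) = accepting
  afterBlank (no  _) = rejecting

  afterLetter : {u : List A} → Dec (u ∈ prefixes) → State
  afterLetter (yes u∈prefixes) = reading (index u∈prefixes)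
  afterLetter (no  _)          = rejecting

  next : State → Maybe A → State
  next (reading i) (just a) = afterLetter (lookup prefixes i ∷ʳ a ∈? prefixes)
  next (reading i) nothing  = afterBlank (lookup prefixes i ∈? ws)
  next q           _        = q

  machine : TuringMachine A
  machine = record
    { Γ             = Maybe A
    ; Γ-finite      = Maybe-finite A-finite
    ; inclusion     = mk↣ just-injective
    ; blank         = nothing
    ; blank-fresh   = λ _ ()
    ; Q             = State
    ; Q-finite      = _ , ↔-refl
    ; start         = reading 0F
    ; accept        = accepting
    ; reject        = rejecting
    ; start≢accept  = λ ()
    ; start≢reject  = λ ()
    ; accept≢reject = λ ()
    ; δ             = λ (q , s) → next (value q) s , s , right
    }

  open TuringMachine machine
  open Determinism machine

  -- `δ` writes back the scanned symbol, so a step leaves every cell as it was. The claim is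
  -- pointwise because tapes are functions.
  write-same : ∀ t h {s} → t h ≡ s → ∀ j → write t h s j ≡ t j
  write-same t h th≡s j with j ℤ.≟ h
  ... | yes refl = sym th≡s
  ... | no  _    = refl

  -- The invariant on the unread input `w`. It constrains only the cells from the head rightwards,
  -- since the head never turns back; beyond `w` it demands blanks.
  Holds : Tape → ℤ → List A → Set
  Holds t h w = ∀ n → t (h ℤ.+ + n) ≡ cells w n

  Holds-head : ∀ t h w → Holds t h w → t h ≡ cells w 0
  Holds-head t h w holds = trans (cong t (sym (ℤ.+-identityʳ h))) (holds 0)

  Holds-move : ∀ t h a w → Holds t h (a ∷ w) → Holds (write t h (just a)) (move right h) w
  Holds-move t h a w holds n =
    trans (write-same t h (Holds-head t h (a ∷ w) holds) _)
      -- Offset `n` from the new head is offset `suc n` from the old one.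
      (trans (cong t (ℤ.+-assoc h 1ℤ (+ n))) (holds (suc n)))

  data Decides (w : List A) (c : Config) : Set where
    accepted : state c ≡ accept → w ∈ ws → Decides w c
    rejected : state c ≡ reject → w ∉ ws → Decides w c

  Decides⇒Halted : ∀ {w c} → Decides w c → Halted c
  Decides⇒Halted (accepted acc _) = inj₁ acc
  Decides⇒Halted (rejected rej _) = inj₂ rej

  accepted∈ : ∀ {w c} → Decides w c → state c ≡ accept → w ∈ ws
  accepted∈ (accepted _   w∈ws) _   = w∈ws
  accepted∈ (rejected rej _)    acc = ⊥-elim (accept≢reject (trans (sym acc) rej))

  -- The scanned symbol is a separate variable, so that `next` can compute once `Holds` identifies
  -- it as a letter or the blank.
  read : ∀ {i t h s} → t h ≡ s →
         ⟨ reading i , t , h ⟩ ⟶ ⟨ next (reading i) s , write t h s , move right h ⟩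
  read {i} refl = step ((λ ()) , (λ ())) refl

  -- Induction on the unread part `w`, with `lookup prefixes i` the part already read. Each letter
  -- costs at most one step, and the final blank accounts for the `+ 1`.
  decide : ∀ w i t h → Holds t h w →
           ∃[ n ] ∃[ c ] (n ≤ length w + 1 × ⟨ reading i , t , h ⟩ ⟶[ n ] c ×
                          Decides (lookup prefixes i ++ w) c)
  decide [] i t h holds rewrite List.++-identityʳ (lookup prefixes i)
    -- Abstracting the step together with the test makes its target state compute in each branch.
    with lookup prefixes i ∈? ws | read {i} {t} {h} (Holds-head t h [] holds)
  ... | yes u∈ws | s = 1 , _ , ℕ.≤-refl , s ◅ done , accepted refl u∈ws
  ... | no  u∉ws | s = 1 , _ , ℕ.≤-refl , s ◅ done , rejected refl u∉ws
  decide (a ∷ w) i t h holds rewrite sym (List.∷ʳ-++ (lookup prefixes i) a w)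
    with lookup prefixes i ∷ʳ a ∈? prefixes | read {i} {t} {h} (Holds-head t h (a ∷ w) holds)
  ... | no ua∉prefixes | s =
    1 , _ , s≤s z≤n , s ◅ done , rejected refl (ua∉prefixes ∘ ++∈⇒∈prefixes _ w)
  ... | yes ua∈prefixes | s
    with n , c , n≤ , run , decides ← decide w (index ua∈prefixes) _ _ (Holds-move t h a w holds) =
    suc n , c , s≤s n≤ , s ◅ run ,
    -- The new state stores only a position; the word found there is the old prefix extended by `a`.
    subst (λ u → Decides (u ++ w) c) (sym (lookup-index ua∈prefixes)) decides

  decide-initial : ∀ w → ∃[ n ] ∃[ c ] (n ≤ length w + 1 × initial w ⟶[ n ] c × Decides w c)
  -- Position `0F` holds `[]`, and offsets from `0ℤ` compute to the cell numbers themselves, so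
  -- `refl` gives the invariant.
  decide-initial w = decide w 0F (inputTape w) 0ℤ (λ _ → refl)

  stopsWithin : ∀ w → StopsWithin (length w + 1) w
  stopsWithin w with n , c , n≤ , run , decides ← decide-initial w =
    n , c , n≤ , run , Decides⇒Halted decides

  accepts⇔∈ : ∀ w → w ∈ ws ⇔ Accepts w
  accepts⇔∈ w with n , c , _ , run , decides ← decide-initial w = mk⇔ (to decides) from
    where
    to : Decides w c → w ∈ ws → Accepts w
    to (accepted acc _)    _    = n , c , run , acc
    to (rejected _   w∉ws) w∈ws = ⊥-elim (w∉ws w∈ws)

    from : Accepts w → w ∈ ws
    from (_ , c′ , run′ , acc)
      -- The given accepting run ends in the configuration reached by `decide`, whose verdict
      -- therefore applies.
      with refl ← halting-unique run (Decides⇒Halted decides) run′ (inj₁ acc) =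
      accepted∈ decides acc

proposition1 : (A : Set) → Finite A → (L : Language A) → FiniteLanguage L →
    ∃[ M ] (TuringMachine.AcceptsLanguage {A} M L ×
    ((k : ℕ) (w : List A) → length w ≡ k → TuringMachine.StopsWithin M (k + 1) w))
proposition1 A A-finite L (ws , L⇔∈ws) =
  machine , (λ w → accepts⇔∈ w ⇔-∘ L⇔∈ws w) , λ { _ w refl → stopsWithin w }
  where open PrefixMachine A-finite ws
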